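{- An infinite cardinal $\kappa$ is greatly inaccessible if and only if $\kappa$ is Mahlo.
   Context: A cardinal is inaccessible if it is an uncountable regular strong limit cardinal. An infinite cardinal $\kappa$ is Mahlo if and only if the set of inaccessible cardinals below $\kappa$ is a stationary subset of $\kappa$. For $X\subseteq\kappa$ let $\mathcal{I}(X)=\{\alpha\in X : \alpha \text{ is an inaccessible cardinal and a limit point of } X\}$. A cardinal $\kappa$ is greatly inaccessible if and only if there is a (proper) filter $F$ on $\kappa$ which is uniform (for every $\beta<\kappa$ the set $[\beta,\kappa)$ is in $F$), normal (closed under diagonal intersections $\Delta_{\alpha<\kappa}X_\alpha=\{\gamma<\kappa : \gamma\in\bigcap_{\alpha<\gamma}X_\alpha\}$), and closed under $\mathcal{I}$ (if $X\in F$ then $\mathcal{I}(X)\in F$). -}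

module Defs where

open import Data.Bool.Base using (Bool)
open import Data.Nat.Base using (ℕ)
open import Data.Product.Base using (Σ-syntax; ∃-syntax; _×_)
open import Data.Refinement using (Refinement-syntax; value; value-injective)
open import Function.Base using (_on_)
open import Function.Bundles using (Injection; _↣_; _⤖_)
open import Level using (Level; _⊔_; suc)
open import Induction.WellFounded using (WellFounded)
open import Relation.Binary.Bundles using (Setoid)
open import Relation.Binary.Core using (Rel)
open import Relation.Binary.Definitions using (Tri; tri<; tri≈; tri>)
open import Relation.Binary.PropositionalEquality
  using (_≡_; refl; cong; setoid; _→-setoid_; isEquivalence; resp₂)
open import Relation.Binary.Structures using (IsStrictTotalOrder)
open import Relation.Nullary.Negation.Core using (¬_)
open import Relation.Unary using (Pred; _∈_; _⊆_; _∩_; _≬_)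
open import Relation.Unary.Polymorphic using (∅; U)
import Relation.Binary.Construct.On as On
import Relation.Binary.Construct.StrictToNonStrict as ToNonStrict

-- Ordinals are represented by well-ordered types: an ordinal is the set of
-- smaller ordinals, so the elements of the carrier are the ordinals below it.

record WellOrder (ℓ : Level) : Set (suc ℓ) where
  field
    Carrier            : Set ℓ
    _<_                : Rel Carrier ℓ
    isStrictTotalOrder : IsStrictTotalOrder _≡_ _<_
    wellFounded        : WellFounded _<_

  open IsStrictTotalOrder isStrictTotalOrder public using (trans; compare)
  open ToNonStrict _≡_ _<_ public using (_≤_)

open WellOrder using (Carrier)

-- The element α, regarded as an ordinal in its own right.  The proof of γ < α
-- is irrelevant, so that elements are equal as soon as their values are.

below : ∀ {ℓ} (κ : WellOrder ℓ) → Carrier κ → WellOrder ℓ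
below κ α = record
  { Carrier            = [ γ ∈ K ∣ γ < α ]
  ; _<_                = _<_ on value
  ; isStrictTotalOrder = record
    { isStrictPartialOrder = record
      { isEquivalence = isEquivalence
      ; irrefl        = λ { refl → irrefl refl }
      ; trans         = trans
      ; <-resp-≈      = resp₂ (_<_ on value)
      }
    ; compare = λ x y → reflectTri (compare (value x) (value y))
    }
  ; wellFounded        = On.wellFounded value wellFounded
  }
  where
  open WellOrder κ renaming (Carrier to K)
  open IsStrictTotalOrder isStrictTotalOrder using (irrefl)

  reflectTri : ∀ {x y : [ γ ∈ K ∣ γ < α ]} →
               Tri (value x < value y) (value x ≡ value y) (value y < value x) →
               Tri (value x < value y) (x ≡ y) (value y < value x)
  reflectTri (tri< a ¬b ¬c) = tri< a (λ e → ¬b (cong value e)) ¬c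
  reflectTri (tri≈ ¬a b ¬c) = tri≈ ¬a (value-injective b) ¬c
  reflectTri (tri> ¬a ¬b c) = tri> ¬a (λ e → ¬b (cong value e)) c

-- Strict inequality of cardinalities.  Setoids are used so that 2^β can be
-- taken with pointwise equality of functions.

infix 4 _≺_

_≺_ : ∀ {a b c d} → Setoid a b → Setoid c d → Set (a ⊔ b ⊔ c ⊔ d)
S ≺ T = Injection S T × ¬ Injection T S

module _ {ℓ} (κ : WellOrder ℓ) where

  open WellOrder κ using (_≤_) renaming (Carrier to K)

  -- Cardinals are the initial ordinals.

  IsCardinal : Set ℓ
  IsCardinal = ∀ α → ¬ (K ⤖ Carrier (below κ α))

  IsInfiniteCardinal : Set ℓ
  IsInfiniteCardinal = IsCardinal × (ℕ ↣ K)

  Uncountable : Set ℓ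
  Uncountable = ¬ (K ↣ ℕ)

  Cofinal : {A : Set ℓ} → (A → K) → Set ℓ
  Cofinal f = ∀ γ → ∃[ x ] γ ≤ f x

  -- cf(κ) = κ: there is no cofinal map into κ from a smaller ordinal.

  IsRegular : Set ℓ
  IsRegular = IsInfiniteCardinal ×
              (∀ β (f : Carrier (below κ β) → K) → ¬ Cofinal f)

  IsStrongLimit : Set ℓ
  IsStrongLimit = ∀ β → (Carrier (below κ β) →-setoid Bool) ≺ setoid K

  IsInaccessible : Set ℓ
  IsInaccessible = Uncountable × IsRegular × IsStrongLimit

module _ {ℓ} (κ : WellOrder ℓ) where

  open WellOrder κ using (_<_; _≤_) renaming (Carrier to K)

  Inaccessibles : Pred K ℓ
  Inaccessibles α = IsInaccessible (below κ α)

  -- α ≠ 0 and sup (X ∩ α) = α.  The first conjunct excludes α = 0, for which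
  -- the second holds vacuously.

  IsLimitPoint : Pred K ℓ → Pred K ℓ
  IsLimitPoint X α = (∃[ β ] β < α) ×
                     (∀ β → β < α → ∃[ γ ] γ ∈ X × β < γ × γ < α)

  IsUnbounded : Pred K ℓ → Set ℓ
  IsUnbounded X = ∀ β → ∃[ γ ] γ ∈ X × β ≤ γ

  IsClosed : Pred K ℓ → Set ℓ
  IsClosed X = IsLimitPoint X ⊆ X

  IsClub : Pred K ℓ → Set ℓ
  IsClub C = IsClosed C × IsUnbounded C

  IsStationary : Pred K ℓ → Set (suc ℓ)
  IsStationary S = ∀ C → IsClub C → S ≬ C

  IsMahlo : Set (suc ℓ)
  IsMahlo = IsStationary Inaccessibles

  𝓘 : Pred K ℓ → Pred K ℓ
  𝓘 X = X ∩ Inaccessibles ∩ IsLimitPoint X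

  Δ : (K → Pred K ℓ) → Pred K ℓ
  Δ X γ = ∀ α → α < γ → γ ∈ X α

  record IsProperFilter {f} (F : Pred (Pred K ℓ) f) : Set (suc ℓ ⊔ f) where
    field
      whole    : U ∈ F
      ∩-closed : ∀ {X Y} → X ∈ F → Y ∈ F → X ∩ Y ∈ F
      upward   : ∀ {X Y} → X ⊆ Y → X ∈ F → Y ∈ F
      proper   : ¬ (∅ ∈ F)

  IsUniform : ∀ {f} → Pred (Pred K ℓ) f → Set (ℓ ⊔ f)
  IsUniform F = ∀ β → (β ≤_) ∈ F

  IsNormal : ∀ {f} → Pred (Pred K ℓ) f → Set (suc ℓ ⊔ f)
  IsNormal F = ∀ (X : K → Pred K ℓ) → (∀ α → X α ∈ F) → Δ X ∈ F

  Is𝓘-Closed : ∀ {f} → Pred (Pred K ℓ) f → Set (suc ℓ ⊔ f)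
  Is𝓘-Closed F = ∀ X → X ∈ F → 𝓘 X ∈ F

  IsGreatlyInaccessible : Set (suc (suc ℓ))
  IsGreatlyInaccessible =
    Σ[ F ∈ Pred (Pred K ℓ) (suc ℓ) ]
      IsProperFilter F × IsUniform F × IsNormal F × Is𝓘-Closed F

{-# OPTIONS --safe #-}
-- (⇒) Let F witness that κ is greatly inaccessible and let C be a club, with
-- c(α) ∈ C chosen so that α ≤ c(α).  By uniformity and normality F contains
-- {γ : c(α) ≤ γ for all α < γ}, and every limit ordinal γ in this set is in C:
-- it is a value of c or a limit point of C.  As 𝓘(κ) ∈ F consists of
-- inaccessibles, some inaccessible is in C.
--
-- (⇐) If κ is Mahlo then κ is regular: given a cofinal map f from μ < κ, the
-- ordinals γ > μ in which the values of f below γ are cofinal form a club, and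
-- none of them is regular.  Hence the points closed under a given G : κ → κ
-- form a club, so some of them are inaccessible.  The filter consists of the
-- sets containing, for some G, all inaccessibles closed under G; regularity
-- gives normality, by dominating κ many functions by a single one.

module Submission where

open import Axiom.ExcludedMiddle using (ExcludedMiddle)
open import Data.Empty using (⊥-elim)
open import Data.Irrelevant using ([_])
open import Data.Maybe.Base using (Maybe; just; nothing)
open import Data.Nat.Base using (ℕ; zero; suc)
open import Data.Nat.Properties using (suc-injective)
open import Data.Product.Base using (∃-syntax; _×_; _,_; proj₁; proj₂)
open import Data.Refinement using (value; value-injective; _,_)
open import Data.Unit.Base using (⊤; tt)
open import Data.Sum.Base using (inj₁; inj₂; map₂; [_,_]′)
open import Function.Base using (_∘_)
open import Function.Bundles
  using (_⇔_; mk⇔; _↣_; _⤖_; mk⤖; _↔_; mk↔ₛ′; Injection)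
open import Function.Consequences.Propositional
  using (strictlySurjective⇒surjective)
open import Function.Construct.Composition using (_⤖-∘_)
open import Function.Properties.Inverse using (↔⇒⤖)
open import Level using (Lift; lift; lower) renaming (suc to lsuc)
open import Relation.Binary.Definitions using (tri<; tri≈; tri>)
open import Relation.Binary.PropositionalEquality
  using (_≡_; refl; sym; trans; cong; subst)
open import Relation.Binary.Structures using (IsStrictTotalOrder)
open import Relation.Nullary using (¬_; Dec; yes; no; contradiction)
open import Relation.Nullary.Decidable using (decidable-stable; recompute)
open import Relation.Unary using (Pred; _∈_)
open import Induction.WellFounded using (module All)
open import Defs

open WellOrder using (Carrier)

module _ (em : ∀ {ℓ} → ExcludedMiddle ℓ) where

  -- Classical witnesses and Hilbert's hotel

  ¬∀⇒∃¬ : ∀ {a p} {A : Set a} {P : A → Set p} →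
          ¬ (∀ x → P x) → ∃[ x ] ¬ P x
  ¬∀⇒∃¬ ¬∀ = decidable-stable em λ ¬∃ →
    ¬∀ λ x → decidable-stable em λ ¬p → ¬∃ (x , ¬p)

  leftInverse : ∀ {a} {A : Set a} (i : ℕ ↣ A) →
                ∃[ r ] (∀ n → r (Injection.to i n) ≡ n)
  leftInverse {A = A} i = (λ a → inverse a em) , λ n → inverse-to n em
    where
    open Injection i using (to; injective)

    inverse : ∀ a → Dec (∃[ n ] to n ≡ a) → ℕ
    inverse a (yes (n , _)) = n
    inverse a (no _)        = zero

    inverse-to : ∀ n (d : Dec (∃[ m ] to m ≡ to n)) → inverse (to n) d ≡ n
    inverse-to n (yes (_ , eq)) = injective eq
    inverse-to n (no ¬p)        = contradiction (n , refl) ¬p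

  -- Hilbert's hotel: `nothing` takes the room `to zero`, each `to n` moves to `to (suc n)`, and
  -- points outside the range of `i` stay put.
  Maybe-⤖ : ∀ {a} {A : Set a} → ℕ ↣ A → Maybe A ⤖ A
  Maybe-⤖ {A = A} i =
    mk⤖ (hotel-injective _ _ , strictlySurjective⇒surjective hotel-surjective)
    where
    open Injection i using (to; injective)

    shift : ∀ a → Dec (∃[ n ] to n ≡ a) → A
    shift a (yes (n , _)) = to (suc n)
    shift a (no _)        = a

    hotel : Maybe A → A
    hotel nothing  = to zero
    hotel (just a) = shift a em

    shift≢0 : ∀ a d → ¬ (to zero ≡ shift a d)
    shift≢0 a (yes (n , _)) eq with () ← injective eq
    shift≢0 a (no ¬p)       eq = ¬p (zero , eq)

    shift-injective : ∀ a b d e → shift a d ≡ shift b e → a ≡ b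
    shift-injective a b (yes (m , p)) (yes (n , q)) eq =
      trans (sym p) (trans (cong to (suc-injective (injective eq))) q)
    shift-injective a b (yes (m , _)) (no ¬q)       eq = contradiction (suc m , eq) ¬q
    shift-injective a b (no ¬p)       (yes (n , _)) eq = contradiction (suc n , sym eq) ¬p
    shift-injective a b (no _)        (no _)        eq = eq

    hotel-injective : ∀ x y → hotel x ≡ hotel y → x ≡ y
    hotel-injective nothing  nothing  eq = refl
    hotel-injective nothing  (just b) eq = contradiction eq (shift≢0 b em)
    hotel-injective (just a) nothing  eq = contradiction (sym eq) (shift≢0 a em)
    hotel-injective (just a) (just b) eq = cong just (shift-injective a b em em eq)

    shift-to : ∀ n (d : Dec (∃[ m ] to m ≡ to n)) → shift (to n) d ≡ to (suc n)
    shift-to n (yes (_ , eq)) = cong (to ∘ suc) (injective eq)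
    shift-to n (no ¬p)        = contradiction (n , refl) ¬p

    shift-out : ∀ a d → ¬ (∃[ n ] to n ≡ a) → shift a d ≡ a
    shift-out a (yes p) ¬p = contradiction p ¬p
    shift-out a (no _)  ¬p = refl

    hotel-surjective : ∀ a → ∃[ x ] hotel x ≡ a
    hotel-surjective a with em {P = ∃[ n ] to n ≡ a}
    ... | yes (zero  , eq) = nothing , eq
    ... | yes (suc n , eq) = just (to n) , trans (shift-to n em) eq
    ... | no  ¬p           = just a , shift-out a em ¬p

  module _ {ℓ} (κ : WellOrder ℓ) where

    open WellOrder κ using (_<_; _≤_; compare; wellFounded; isStrictTotalOrder)
      renaming (Carrier to K; trans to <-trans)
    open IsStrictTotalOrder isStrictTotalOrder using (irrefl; _<?_)

    -- Order, least elements and suprema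

    ≤-<-trans : ∀ {x y z} → x ≤ y → y < z → x < z
    ≤-<-trans (inj₁ x<y)  y<z = <-trans x<y y<z
    ≤-<-trans (inj₂ refl) y<z = y<z

    <-≤-trans : ∀ {x y z} → x < y → y ≤ z → x < z
    <-≤-trans x<y (inj₁ y<z)  = <-trans x<y y<z
    <-≤-trans x<y (inj₂ refl) = x<y

    ≮⇒≥ : ∀ {x y} → ¬ x < y → y ≤ x
    ≮⇒≥ {x} {y} x≮y with compare x y
    ... | tri< x<y _ _ = contradiction x<y x≮y
    ... | tri≈ _ eq _  = inj₂ (sym eq)
    ... | tri> _ _ y<x = inj₁ y<x

    join-< : ∀ {α β γ} → α < γ → β < γ → ∃[ ν ] α ≤ ν × β ≤ ν × ν < γ
    join-< {α} {β} α<γ β<γ with compare α β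
    ... | tri< α<β _ _ = β , inj₁ α<β , inj₂ refl , β<γ
    ... | tri≈ _ α≡β _ = β , inj₂ α≡β , inj₂ refl , β<γ
    ... | tri> _ _ β<α = α , inj₂ refl , inj₁ β<α , α<γ

    value< : ∀ {α} (x : Carrier (below κ α)) → value x < α
    value< (γ , [ γ<α ]) = recompute (γ <? _) γ<α

    least : (P : Pred K ℓ) → ∀ x → P x → ∃[ y ] P y × (∀ z → P z → y ≤ z)
    least P = All.wfRec wellFounded ℓ _ step
      where
      step : ∀ x → (∀ {y} → y < x → P y → ∃[ m ] P m × (∀ z → P z → m ≤ z)) →
             P x → ∃[ y ] P y × (∀ z → P z → y ≤ z)
      step x rec px with em {P = ∃[ y ] y < x × P y}
      ... | yes (y , y<x , py) = rec y<x py
      ... | no  none           = x , px , λ z pz → ≮⇒≥ λ z<x → none (z , z<x , pz)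

    -- `γ` is the least strict upper bound, so no `ε < γ` is one and some value reaches `ε`.
    supremum : {A : Set} (f : A → K) → ∃[ b ] (∀ x → f x < b) →
               ∃[ γ ] (∀ x → f x < γ) × (∀ ε → ε < γ → ∃[ x ] ε ≤ f x)
    supremum f (b , f<b) with least (λ γ → ∀ x → f x < γ) b f<b
    ... | γ , f<γ , minimal = γ , f<γ , λ ε ε<γ →
      let x , fx≮ε = ¬∀⇒∃¬ λ f<ε → irrefl refl (<-≤-trans ε<γ (minimal ε f<ε))
      in  x , ≮⇒≥ fx≮ε

    -- The order is `m + 1`, that is, the segment below `m` with `m` added as `nothing`; the hotel
    -- absorbs this extra point.
    ⤖-below-maximum : ∀ {m} → (∀ x → x ≤ m) → ℕ ↣ Carrier (below κ m) →
                      K ⤖ Carrier (below κ m)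
    ⤖-below-maximum {m} x≤m i = Maybe-⤖ i ⤖-∘ ↔⇒⤖ split
      where
      to : K → Maybe (Carrier (below κ m))
      to x with x <? m
      ... | yes x<m = just (x , [ x<m ])
      ... | no  _   = nothing

      from : Maybe (Carrier (below κ m)) → K
      from (just x) = value x
      from nothing  = m

      to-from : ∀ y → to (from y) ≡ y
      to-from (just x) with value x <? m
      ... | yes _   = refl
      ... | no  x≮m = contradiction (value< x) x≮m
      to-from nothing with m <? m
      ... | yes m<m = contradiction m<m (irrefl refl)
      ... | no  _   = refl

      from-to : ∀ x → from (to x) ≡ x
      from-to x with x <? m
      ... | yes _   = refl
      ... | no  x≮m with x≤m x
      ...   | inj₁ x<m = contradiction x<m x≮m
      ...   | inj₂ eq  = sym eq

      split : K ↔ Maybe (Carrier (below κ m))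
      split = mk↔ₛ′ to from to-from from-to

    -- Consequences of inaccessibility

    inaccessible-infinite : ∀ {γ} → Inaccessibles κ γ → ℕ ↣ Carrier (below κ γ)
    inaccessible-infinite (_ , ((_ , i) , _) , _) = i

    inaccessible-nonzero : ∀ {γ} → Inaccessibles κ γ → ∃[ β ] β < γ
    inaccessible-nonzero inacc = value x , value< x
      where x = Injection.to (inaccessible-infinite inacc) zero

    -- Regularity of `γ` speaks of maps into its own segment, whereas `f` may leave `γ`. Redirecting
    -- the values outside `γ` does no harm, since cofinality is witnessed by values below `γ`.
    inaccessible-regular : ∀ {γ μ} → Inaccessibles κ γ → μ < γ →
      (f : Carrier (below κ μ) → K) →
      ¬ (∀ ε → ε < γ → ∃[ x ] ε ≤ f x × f x < γ)
    inaccessible-regular {γ} {μ} (_ , (_ , regular) , _) μ<γ f cofinal =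
      regular μ′ f′ λ ε → let x , ε≤fx , fx<γ = cofinal (value ε) (value< ε) in
        -- The source of `f′` is a segment of a segment, so its points carry a bound by `γ` and a
        -- bound by `μ`.
        (((value x , [ <-trans (value< x) μ<γ ]) , [ value< x ])) ,
        map₂ value-injective
          (subst (value ε ≤_) (sym (value-restrict fx<γ)) ε≤fx)
      where
      μ′ : Carrier (below κ γ)
      μ′ = μ , [ μ<γ ]

      -- μ is an arbitrary default for the points outside γ.
      restrict : K → Carrier (below κ γ)
      restrict y with y <? γ
      ... | yes y<γ = y , [ y<γ ]
      ... | no  _   = μ′

      value-restrict : ∀ {y} → y < γ → value (restrict y) ≡ y
      value-restrict {y} y<γ with y <? γ
      ... | yes _   = refl
      ... | no  y≮γ = contradiction y<γ y≮γ

      f′ : Carrier (below (below κ γ) μ′) → Carrier (below κ γ)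
      f′ (x , [ x<μ ]) = restrict (f (value x , [ x<μ ]))

    -- From the filter to stationarity

    greatlyInaccessible⇒mahlo : IsGreatlyInaccessible κ → IsMahlo κ
    greatlyInaccessible⇒mahlo (F , filter , uniform , normal , 𝓘-closed) C (closed , unbounded) =
      -- If `C` missed all inaccessibles, the set in `F` obtained below would be contained in the
      -- empty set.
      decidable-stable em λ disjoint → proper
        (upward (λ { ((_ , inacc , limit) , above) →
                   ⊥-elim (disjoint (_ , inacc , inClub limit above)) })
                (∩-closed (𝓘-closed _ whole) (normal _ λ α → uniform (c α))))
      where
      open IsProperFilter filter

      c : K → K
      c α = proj₁ (unbounded α)

      inClub : ∀ {γ} → IsLimitPoint κ _ γ → (∀ α → α < γ → c α ≤ γ) → γ ∈ C
      inClub {γ} (nonzero , limit) above with em {P = ∃[ α ] α < γ × c α ≡ γ}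
      ... | yes (α , _ , refl) = proj₁ (proj₂ (unbounded α))
      ... | no  c≢γ = closed (nonzero , λ β β<γ →
        -- As `γ` is a limit, there is room for `α` strictly between `β` and `γ`, whence
        -- `β < α ≤ c α < γ`.
        let α , _ , β<α , α<γ = limit β β<γ
            _ , cα∈C , α≤cα   = unbounded α
        in  c α , cα∈C , <-≤-trans β<α α≤cα ,
            [ (λ cα<γ → cα<γ) , (λ eq → contradiction (α , α<γ , eq) c≢γ) ]′
              (above α α<γ))

    module _ (isCardinal : IsCardinal κ) (mahlo : IsMahlo κ) where

      -- Regularity of Mahlo cardinals

      inaccessible-exists : ∃[ γ ] Inaccessibles κ γ
      inaccessible-exists =
        let γ , inacc , _ = mahlo (λ _ → Lift ℓ ⊤) (_ , λ β → β , _ , inj₂ refl)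
        in  γ , inacc

      -- If m were the maximum then {m} would be a club, so m would be inaccessible,
      -- in particular infinite, and κ = m + 1 would be equinumerous with m.
      noMaximum : ∀ m → ∃[ x ] m < x
      noMaximum m = decidable-stable em λ maximal →
        let x≤m : ∀ x → x ≤ m
            x≤m x = ≮⇒≥ λ m<x → maximal (x , m<x)
            m-isClub : IsClub κ (_≡ m)
            m-isClub =
              (λ { ((β , β<γ) , limit) → let _ , δ≡m , _ , δ<γ = limit β β<γ in
                   contradiction (_ , subst (_< _) δ≡m δ<γ) maximal }) ,
              (λ β → m , refl , x≤m β)
        in m-inaccessible x≤m (mahlo _ m-isClub)
        where
        m-inaccessible : (∀ x → x ≤ m) → ¬ (∃[ γ ] Inaccessibles κ γ × γ ≡ m)
        m-inaccessible x≤m (_ , inacc , refl) =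
          isCardinal m (⤖-below-maximum x≤m (inaccessible-infinite inacc))

      upperBound : ∀ α β → ∃[ γ ] α < γ × β < γ
      upperBound α β with compare α β
      ... | tri< α<β _ _  = let γ , β<γ = noMaximum β in γ , <-trans α<β β<γ , β<γ
      ... | tri≈ _ refl _ = let γ , β<γ = noMaximum β in γ , β<γ , β<γ
      ... | tri> _ _ β<α  = let γ , α<γ = noMaximum α in γ , α<γ , <-trans β<α α<γ

      regular : ∀ μ (f : Carrier (below κ μ) → K) → ¬ Cofinal κ f
      regular μ f cofinal =
        let _ , inacc , μ<γ , accumulates = mahlo Accumulation (closed , unbounded)
        in  inaccessible-regular inacc μ<γ f accumulates
        where
        Accumulation : Pred K ℓ
        Accumulation γ = μ < γ × (∀ ε → ε < γ → ∃[ x ] ε ≤ f x × f x < γ)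

        closed : IsClosed κ Accumulation
        closed ((β , β<γ) , limit) =
          (let _ , (μ<δ , _) , _ , δ<γ = limit β β<γ in <-trans μ<δ δ<γ) ,
          λ ε ε<γ →
            let _ , (_ , accumulates) , ε<δ , δ<γ = limit ε ε<γ
                x , ε≤fx , fx<δ = accumulates ε ε<δ
            in  x , ε≤fx , <-trans fx<δ δ<γ

        unbounded : IsUnbounded κ Accumulation
        unbounded β =
          let u , β<u , μ<u = upperBound β μ
              x , u≤fx = cofinal u
              -- `γ` is the successor of `f x`, taken as the supremum of a one-point family: each
              -- `ε < γ` is at most `f x`, so the single value `f x` is already cofinal in `γ`.
              γ , fx<γ , ε≤fx = supremum {A = ⊤} (λ _ → f x)
                                  (let b , fx<b = noMaximum (f x) in b , λ _ → fx<b)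
              u<γ = ≤-<-trans u≤fx (fx<γ tt)
          in  γ , (<-trans μ<u u<γ , λ ε ε<γ → x , proj₂ (ε≤fx ε ε<γ) , fx<γ tt) ,
              inj₁ (<-trans β<u u<γ)

      bounded : ∀ {μ} (f : Carrier (below κ μ) → K) → ∃[ b ] (∀ x → f x < b)
      bounded {μ} f = decidable-stable em λ unbounded → regular μ f λ γ →
        let x , fx≮γ = ¬∀⇒∃¬ λ f<γ → unbounded (γ , f<γ) in x , ≮⇒≥ fx≮γ

      -- The natural numbers embed in an inaccessible below `κ`. Composing `h` with a left inverse
      -- of the embedding gives a map on a proper segment, which regularity bounds.
      bounded-ℕ : (h : ℕ → K) → ∃[ b ] (∀ n → h n < b)
      bounded-ℕ h =
        let _ , inacc = inaccessible-exists
            i = inaccessible-infinite inacc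
            r , r-to = leftInverse i
            b , h<b  = bounded (h ∘ r)
        in  b , λ n → subst (λ k → h k < b) (r-to n) (h<b (Injection.to i n))

      -- For fixed `ν`, regularity is applied twice: to bound `g α β` over `β ≤ ν` for each `α`, and
      -- then to bound these bounds over `α ≤ ν`.
      dominate : (g : K → K → K) →
        ∃[ G ] (∀ {α β ν} → α ≤ ν → β ≤ ν → g α β < G ν)
      dominate g = (λ ν → proj₁ (outer ν)) , λ {α} {β} {ν} α≤ν β≤ν →
        <-trans (proj₂ (inner ν α) (β , [ ≤-<-trans β≤ν (proj₂ (noMaximum ν)) ]))
                (proj₂ (outer ν)   (α , [ ≤-<-trans α≤ν (proj₂ (noMaximum ν)) ]))
        where
        -- Cutting at a point above `ν` keeps `ν` itself in the segment.
        Segment : K → Set ℓ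
        Segment ν = Carrier (below κ (proj₁ (noMaximum ν)))

        inner : ∀ ν α → ∃[ b ] (∀ (y : Segment ν) → g α (value y) < b)
        inner ν α = bounded _

        outer : ∀ ν → ∃[ b ] (∀ (x : Segment ν) → proj₁ (inner ν (value x)) < b)
        outer ν = bounded _

      -- Inaccessible closure points

      ClosedUnder : (K → K) → Pred K ℓ
      ClosedUnder G γ = ∀ α → α < γ → G α < γ

      inaccessible-closurePoint : ∀ G δ →
        ∃[ γ ] Inaccessibles κ γ × δ < γ × ClosedUnder G γ
      inaccessible-closurePoint G δ = mahlo C (closed , unbounded)
        where
        C : Pred K ℓ
        C γ = δ < γ × ClosedUnder G γ

        closed : IsClosed κ C
        closed ((β , β<γ) , limit) =
          (let _ , (δ<ε , _) , _ , ε<γ = limit β β<γ in <-trans δ<ε ε<γ) ,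
          λ α α<γ → let _ , (_ , closed-ε) , α<ε , ε<γ = limit α α<γ in
            <-trans (closed-ε α α<ε) ε<γ

        -- `G` need not be monotone, so `next ν` is made to exceed `ν` and `G α` for every `α ≤ ν`.
        next : K → K
        next = proj₁ (dominate λ α β → proj₁ (upperBound (G α) β))

        next-upper : ∀ {α ν} → α ≤ ν → G α < next ν × ν < next ν
        next-upper {α} {ν} α≤ν =
          let u , Gα<u , ν<u = upperBound (G α) ν
              u<next = proj₂ (dominate λ α β → proj₁ (upperBound (G α) β)) α≤ν (inj₂ refl)
          in  <-trans Gα<u u<next , <-trans ν<u u<next

        unbounded : IsUnbounded κ C
        unbounded β =
          let u , β<u , δ<u = upperBound β δ
              -- `γ` is the supremum of the iterates of `next` from `u`: if `α ≤ h u n`, then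
              -- `G α < h u (suc n) < γ`.
              γ , h<γ , ε≤h = supremum (h u) (bounded-ℕ (h u))
          in  γ , (<-trans δ<u (h<γ zero) , λ α α<γ →
                    let n , α≤hn = ε≤h α α<γ
                    in  <-trans (proj₁ (next-upper α≤hn)) (h<γ (suc n))) ,
              inj₁ (<-trans β<u (h<γ zero))
          where
          h : K → ℕ → K
          h u zero    = u
          h u (suc n) = next (h u n)

      -- The filter of closure points

      Closure : Pred (Pred K ℓ) ℓ
      Closure X = ∃[ G ] (∀ {γ} → Inaccessibles κ γ → ClosedUnder G γ → γ ∈ X)

      join : ∀ G H → ∃[ J ] (∀ {γ} → ClosedUnder J γ → ClosedUnder G γ × ClosedUnder H γ)
      join G H = (λ α → proj₁ (upperBound (G α) (H α))) , λ closed →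
        (λ α α<γ → <-trans (proj₁ (proj₂ (upperBound (G α) (H α)))) (closed α α<γ)) ,
        (λ α α<γ → <-trans (proj₂ (proj₂ (upperBound (G α) (H α)))) (closed α α<γ))

      -- Properness holds because every `G` has an inaccessible closure point. `Lift` raises
      -- `Closure` to the universe level that the filter must have.
      closure-isProperFilter : IsProperFilter κ (Lift (lsuc ℓ) ∘ Closure)
      closure-isProperFilter = record
        { whole    = lift ((λ α → α) , _)
        ; ∩-closed = λ { (lift (G , p)) (lift (H , q)) →
            let J , closed = join G H
            in lift (J , λ inacc c → p inacc (proj₁ (closed c)) , q inacc (proj₂ (closed c))) }
        ; upward   = λ { X⊆Y (lift (G , p)) → lift (G , λ inacc c → X⊆Y (p inacc c)) }
        ; proper   = λ { (lift (G , p)) →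
            let β , _ = inaccessible-exists
                _ , inacc , _ , closed = inaccessible-closurePoint G β
            in  lower (p inacc closed) }
        }

      -- A nonzero point closed under the constant function `β` lies above `β`.
      closure-uniform : IsUniform κ (Lift (lsuc ℓ) ∘ Closure)
      closure-uniform β = lift ((λ _ → β) , λ inacc closed →
        let α , α<γ = inaccessible-nonzero inacc in inj₁ (closed α α<γ))

      -- Let `γ` be closed under the function dominating all `g α`. For `α , β < γ`, their maximum
      -- `ν` is below `γ` and bounds `g α β` by a value below `γ`; so `γ` is closed under each `g α`
      -- with `α < γ`.
      closure-normal : IsNormal κ (Lift (lsuc ℓ) ∘ Closure)
      closure-normal X X∈F = lift (proj₁ (dominate g) , λ inacc closed α α<γ →
        proj₂ (lower (X∈F α)) inacc λ β β<γ →
          let ν , α≤ν , β≤ν , ν<γ = join-< α<γ β<γ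
          in  <-trans (proj₂ (dominate g) α≤ν β≤ν) (closed ν ν<γ))
        where
        g : K → K → K
        g α = proj₁ (lower (X∈F α))

      -- Besides `G`, use the function sending `α` to an inaccessible closure point of `G` above
      -- `α`. Such points lie in `X`, and closure under this function makes `γ` a limit of them.
      closure-𝓘-closed : Is𝓘-Closed κ (Lift (lsuc ℓ) ∘ Closure)
      closure-𝓘-closed X (lift (G , p)) =
        let J , closed-J = join G (λ α → proj₁ (inaccessible-closurePoint G α))
        in  lift (J , λ inacc closed →
              p inacc (proj₁ (closed-J closed)) , inacc , inaccessible-nonzero inacc ,
              λ β β<γ →
                let δ , inacc-δ , β<δ , closed-δ = inaccessible-closurePoint G β
                in  δ , p inacc-δ closed-δ , β<δ , proj₂ (closed-J closed) β β<γ)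

      mahlo⇒greatlyInaccessible : IsGreatlyInaccessible κ
      mahlo⇒greatlyInaccessible =
        Lift (lsuc ℓ) ∘ Closure , closure-isProperFilter , closure-uniform ,
        closure-normal , closure-𝓘-closed

theorem10 : (∀ {ℓ} → ExcludedMiddle ℓ) →
    ∀ {ℓ} (κ : WellOrder ℓ) → IsInfiniteCardinal κ →
    IsGreatlyInaccessible κ ⇔ IsMahlo κ
theorem10 em κ (isCardinal , _) = mk⇔
  (greatlyInaccessible⇒mahlo em κ)
  (mahlo⇒greatlyInaccessible em κ isCardinal)
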